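{- For every $n\in\mathbb N$, the tuple $(\mathbb{T}_{n+1}^-,\iota^n,\kappa^n)$ is a Kruskal derivative of the normal PO-dilator $M\circ\mathbb{T}_n$, where $\iota^n_X:X\to\mathbb{T}_{n+1}^-(X)$ is $\iota^n_X(x)=\overline x$ and $\kappa^n_X:M(\mathbb{T}_n(\mathbb{T}_{n+1}^-(X)))\to\mathbb{T}_{n+1}^-(X)$ is $\kappa^n_X([s_0,\dots,s_{m-1}])=0\star[\pi^n_X(s_0),\dots,\pi^n_X(s_{m-1})]$.
   Context: A quasi embedding between partial orders $X,Y$ is a function $f$ with $f(x)\leq_Y f(y)\Rightarrow x\leq_X y$; an embedding also satisfies the converse. $\mathrm{PO}$ is the category of partial orders and quasi embeddings. $[X]^{<\omega}$ denotes finite subsets, $[f]^{<\omega}(a)=\{f(x)\mid x\in a\}$. A PO-dilator is a functor $W:\mathrm{PO}\to\mathrm{PO}$ mapping embeddings to embeddings, with a natural transformation $\operatorname{supp}^W:W\Rightarrow[\cdot]^{<\omega}$ such that for every embedding $f:X\to Y$, $\operatorname{rng}(W(f))=\{\sigma\in W(Y)\mid\operatorname{supp}^W_Y(\sigma)\subseteq\operatorname{rng}(f)\}$. For finite $a,b\subseteq X$, $a\leq^{\mathrm{fin}}_X b$ iff every $x\in a$ has some $y\in b$ with $x\leq_X y$ ($z\leq^{\mathrm{fin}}_X b$ means $\{z\}\leq^{\mathrm{fin}}_X b$). $W$ is normal if $\sigma\leq_{W(X)}\tau$ implies $\operatorname{supp}^W_X(\sigma)\leq^{\mathrm{fin}}_X\operatorname{supp}^W_X(\tau)$.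 The composition $V\circ W$ of PO-dilators is the composite functor with $\operatorname{supp}^{V\circ W}_X(\sigma)=\bigcup\{\operatorname{supp}^W_X(s)\mid s\in\operatorname{supp}^V_{W(X)}(\sigma)\}$. A Kruskal fixed point of $W$ over $X$ is a partial order $Z$ with $\iota:X\to Z$, $\kappa:W(Z)\to Z$ such that $\operatorname{rng}(\iota)\cap\operatorname{rng}(\kappa)=\emptyset$ and, for all $x,y\in X$, $\sigma,\tau\in W(Z)$: $\iota(x)\leq_Z\iota(y)\Rightarrow x\leq_X y$; $\iota(x)\leq_Z\kappa(\tau)$ iff $\iota(x)\leq^{\mathrm{fin}}_Z\operatorname{supp}^W_Z(\tau)$; $\kappa(\sigma)\not\leq_Z\iota(y)$; $\kappa(\sigma)\leq_Z\kappa(\tau)$ iff ($\sigma\leq_{W(Z)}\tau$ or $\kappa(\sigma)\leq^{\mathrm{fin}}_Z\operatorname{supp}^W_Z(\tau)$). It is initial if for every Kruskal fixed point $(Z',\iota',\kappa')$ of $W$ over $X$ there is a unique quasi embedding $f:Z\to Z'$ with $f\circ\iota=\iota'$ and $f\circ\kappa=\kappa'\circ W(f)$. A Kruskal derivative of a normal PO-dilator $W$ is a tuple $(\mathcal T W,\iota,\kappa)$ with $\mathcal T W$ a normal PO-dilator and families $\iota_X:X\to\mathcal T W(X)$, $\kappa_X:W(\mathcal T W(X))\to\mathcal T W(X)$ such that (i) each $(\mathcal T W(X),\iota_X,\kappa_X)$ is an initial Kruskal fixed point of $W$ over $X$, and (ii) $\iota_Y\circ f=\mathcal T W(f)\circ\iota_X$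 and $\mathcal T W(f)\circ\kappa_X=\kappa_Y\circ W(\mathcal T W(f))$ for every quasi embedding $f:X\to Y$. $M$ is the multiset dilator: $M(X)$ is the set of finite multisets $[x_0,\dots,x_{m-1}]$ over $X$, with $[x_0,\dots,x_{m-1}]\leq_{M(X)}[y_0,\dots,y_{k-1}]$ iff there is an injection $g$ with $x_i\leq_X y_{g(i)}$ for all $i<m$, $M(f)([x_0,\dots])=[f(x_0),\dots]$, $\operatorname{supp}^M_X([x_0,\dots,x_{m-1}])=\{x_0,\dots,x_{m-1}\}$. For $n\in\mathbb N$ and a partial order $X$, $\mathbb{T}_n(X)$ is generated by $\overline x$ ($x\in X$) and $i\star\sigma$ ($\sigma\in M(\mathbb{T}_n(X))$, $i<n$); $\mathbb{T}_n^-(X)=\{\overline x\mid x\in X\}\cup\{0\star\sigma\mid\sigma\in M(\mathbb{T}_n(X))\}$ for $n>0$. The partial order $\leq_{\mathbb{T}_n(X)}$: $\overline x\leq t$ iff either $t=\overline y$ with $x\leq_X y$, or $t=j\star[t_0,\dots,t_{m-1}]$ and $\overline x\leq t_l$ for some $l$; $i\star\sigma\leq t$ iff either $t=i\star\tau$ with $\sigma\leq_{M(\mathbb{T}_n(X))}\tau$, or $t=j\star[t_0,\dots,t_{m-1}]$ with $j\geq i$ and $i\star\sigma\leq t_l$ for some $l$; $\mathbb{T}_n^-(X)$ carries the restricted order. $\mathbb{T}_n(f)(\overline x)=\overline{f(x)}$, $\mathbb{T}_n(f)(i\star[t_0,\dots])=i\star[\mathbb{T}_n(f)(t_0),\dots]$,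 $\mathbb{T}_n^-(f)$ its restriction; $\operatorname{supp}^{\mathbb{T}_n}_X(\overline x)=\{x\}$, $\operatorname{supp}^{\mathbb{T}_n}_X(i\star[t_0,\dots,t_{m-1}])=\bigcup_l\operatorname{supp}^{\mathbb{T}_n}_X(t_l)$, and $\operatorname{supp}^{\mathbb{T}_n^- }_X$ its restriction. With these, $\mathbb{T}_n$ and $\mathbb{T}_{n+1}^-$ are normal PO-dilators. $\pi^n_X:\mathbb{T}_n(\mathbb{T}_{n+1}^-(X))\to\mathbb{T}_{n+1}(X)$ is defined by $\pi^n_X(\overline t)=t$ and $\pi^n_X(i\star[s_0,\dots,s_{m-1}])=(i+1)\star[\pi^n_X(s_0),\dots,\pi^n_X(s_{m-1})]$. -}

module Defs where

open import Data.Fin.Base as Fin using (Fin; zero; suc; toℕ)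
open import Data.Fin.Permutation as Perm using (Permutation; permutation; _⟨$⟩ʳ_; _⟨$⟩ˡ_)
open import Data.Fin.Properties using (pigeonhole)
open import Data.List.Base as List using (List; []; _∷_; [_]; concat; concatMap; tabulate)
import Data.List.Membership.Setoid as Membership
import Data.List.Membership.Setoid.Properties as Membershipₚ
import Data.List.Properties as Listₚ
open import Data.List.Relation.Unary.Any using (here; there)
import Data.List.Relation.Unary.Any.Properties as Anyₚ
open import Data.Nat.Base as ℕ using (ℕ; zero; suc; _⊔_)
import Data.Nat.Properties as ℕₚ
open import Data.Product as Product using (Σ; Σ-syntax; ∃; ∃!; _×_; _,_; proj₁; proj₂)
open import Data.Sum.Base using (_⊎_)
open import Data.Vec.Functional using (Vector)
open import Function.Base using (_∘_)
open import Function.Bundles using (Func; _⇔_)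
open import Function.Definitions using (Injective)
open import Level using (Level) renaming (suc to lsuc)
open import Relation.Binary.Bundles using (Poset)
open import Relation.Binary.Core using (Rel)
open import Relation.Binary.Definitions using (Reflexive; Symmetric; Transitive)
import Relation.Binary.Construct.On as On
open import Relation.Binary.PropositionalEquality as ≡ using (_≡_)
open import Relation.Nullary.Negation using (¬_; contradiction)
open import Relation.Unary using (Pred; _≐_; _⊆_; _∩_; Empty)

private
  variable
    a r ℓ : Level
    A B : Set a
    m k : ℕ

-- Quotients are replaced by setoid equality throughout: a partial order
-- comes with an equality _≈_ with respect to which it is antisymmetric,
-- functions respect it, and ranges are taken up to it.

PO : ∀ ℓ → Set (lsuc ℓ)
PO ℓ = Poset ℓ ℓ ℓ

infix 0 _⟶_

_⟶_ : PO ℓ → PO ℓ → Set ℓ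
X ⟶ Y = Func (Poset.Eq.setoid X) (Poset.Eq.setoid Y)

record QuasiEmbedding (X Y : PO ℓ) : Set ℓ where
  private
    module X = Poset X
    module Y = Poset Y
  field
    function : X ⟶ Y
  open Func function public using (to; cong)
  field
    reflects : ∀ {x y} → to x Y.≤ to y → x X.≤ y

open QuasiEmbedding using (function; reflects)

infixl 20 _·_

_·_ : {X Y : PO ℓ} → QuasiEmbedding X Y → Poset.Carrier X → Poset.Carrier Y
f · x = QuasiEmbedding.to f x

IsEmbedding : {X Y : PO ℓ} → QuasiEmbedding X Y → Set ℓ
IsEmbedding {X = X} {Y} f = ∀ {x y} → x X.≤ y → f · x Y.≤ f · y
  where
  module X = Poset X
  module Y = Poset Y

infix 4 _≗_

_≗_ : {X Y : PO ℓ} → Rel (QuasiEmbedding X Y) ℓ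
_≗_ {Y = Y} f g = ∀ x → f · x Y.≈ g · x
  where module Y = Poset Y

idᵠ : (X : PO ℓ) → QuasiEmbedding X X
idᵠ X = record
  { function = record { to = λ x → x ; cong = λ eq → eq }
  ; reflects = λ le → le
  }

infixr 9 _∘ᵠ_

_∘ᵠ_ : {X Y Z : PO ℓ} → QuasiEmbedding Y Z → QuasiEmbedding X Y → QuasiEmbedding X Z
g ∘ᵠ f = record
  { function = record
    { to   = λ x → g · (f · x)
    ; cong = QuasiEmbedding.cong g ∘ QuasiEmbedding.cong f
    }
  ; reflects = reflects f ∘ reflects g
  }

rng : (X Y : PO ℓ) → X ⟶ Y → Pred (Poset.Carrier Y) ℓ
rng X Y f y = ∃ λ x → Func.to f x Y.≈ y
  where module Y = Poset Y

-- A finite subset is given by a list enumerating it, possibly with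
-- repetitions; lists with the same members denote the same subset.

Finite : PO ℓ → Set ℓ
Finite X = List (Poset.Carrier X)

infix 4 member sameMembers finLeq

member : (X : PO ℓ) → Poset.Carrier X → Finite X → Set ℓ
member X = Membership._∈_ (Poset.Eq.setoid X)

syntax member X x b = x ∈[ X ] b

sameMembers : (X : PO ℓ) → Rel (Finite X) ℓ
sameMembers X b c = (λ x → x ∈[ X ] b) ≐ (λ x → x ∈[ X ] c)

syntax sameMembers X b c = b ≐[ X ] c

finLeq : (X : PO ℓ) → Rel (Finite X) ℓ
finLeq X b c = ∀ {x} → x ∈[ X ] b → ∃ λ y → y ∈[ X ] c × Poset._≤_ X x y

syntax finLeq X b c = b ≤fin[ X ] c

record PODilator ℓ : Set (lsuc ℓ) where
  field
    obj : PO ℓ → PO ℓ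
    mor : {X Y : PO ℓ} → QuasiEmbedding X Y → QuasiEmbedding (obj X) (obj Y)

    -- quasi embeddings are equal when they agree pointwise
    mor-cong : {X Y : PO ℓ} {f g : QuasiEmbedding X Y} → f ≗ g → mor f ≗ mor g
    mor-id   : (X : PO ℓ) → mor (idᵠ X) ≗ idᵠ (obj X)
    mor-∘    : {X Y Z : PO ℓ} (g : QuasiEmbedding Y Z) (f : QuasiEmbedding X Y) →
               mor (g ∘ᵠ f) ≗ mor g ∘ᵠ mor f

    mor-embedding : {X Y : PO ℓ} (f : QuasiEmbedding X Y) →
                    IsEmbedding f → IsEmbedding (mor f)

    supp         : (X : PO ℓ) → Poset.Carrier (obj X) → Finite X
    supp-cong    : (X : PO ℓ) → ∀ {σ τ} → Poset._≈_ (obj X) σ τ →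
                   supp X σ ≐[ X ] supp X τ
    supp-natural : {X Y : PO ℓ} (f : QuasiEmbedding X Y) → ∀ σ →
                   supp Y (mor f · σ) ≐[ Y ] List.map (f ·_) (supp X σ)
    supp-range   : {X Y : PO ℓ} (f : QuasiEmbedding X Y) → IsEmbedding f →
                   rng (obj X) (obj Y) (function (mor f)) ≐
                   (λ σ → (λ y → y ∈[ Y ] supp Y σ) ⊆ rng X Y (function f))

IsNormal : PODilator ℓ → Set (lsuc ℓ)
IsNormal W = ∀ X {σ τ} → Poset._≤_ (obj X) σ τ → supp X σ ≤fin[ X ] supp X τ
  where open PODilator W

record NormalPODilator ℓ : Set (lsuc ℓ) where
  field
    dilator  : PODilator ℓ
    isNormal : IsNormal dilator
  open PODilator dilator public

module _ (W : PODilator ℓ) where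
  open PODilator W

  record IsKruskalFixedPoint (X Z : PO ℓ) (ι : X ⟶ Z) (κ : obj Z ⟶ Z) : Set ℓ where
    private
      module X  = Poset X
      module Z  = Poset Z
      module WZ = Poset (obj Z)
      open Func ι using () renaming (to to ι₀)
      open Func κ using () renaming (to to κ₀)
    field
      disjoint : Empty (rng X Z ι ∩ rng (obj Z) Z κ)
      ι≤ι      : ∀ x y → ι₀ x Z.≤ ι₀ y → x X.≤ y
      ι≤κ      : ∀ x τ → ι₀ x Z.≤ κ₀ τ ⇔ [ ι₀ x ] ≤fin[ Z ] supp Z τ
      κ≰ι      : ∀ σ y → ¬ κ₀ σ Z.≤ ι₀ y
      κ≤κ      : ∀ σ τ → κ₀ σ Z.≤ κ₀ τ ⇔
                         (σ WZ.≤ τ ⊎ [ κ₀ σ ] ≤fin[ Z ] supp Z τ)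

  record IsInitialKruskalFixedPoint (X Z : PO ℓ) (ι : X ⟶ Z) (κ : obj Z ⟶ Z)
         : Set (lsuc ℓ) where
    field
      isKruskalFixedPoint : IsKruskalFixedPoint X Z ι κ
      initial : (Z′ : PO ℓ) (ι′ : X ⟶ Z′) (κ′ : obj Z′ ⟶ Z′) →
                IsKruskalFixedPoint X Z′ ι′ κ′ →
                ∃! _≗_ λ (f : QuasiEmbedding Z Z′) →
                  (∀ x → Poset._≈_ Z′ (f · Func.to ι x) (Func.to ι′ x)) ×
                  (∀ σ → Poset._≈_ Z′ (f · Func.to κ σ) (Func.to κ′ (mor f · σ)))

record IsKruskalDerivative (W 𝒯W : NormalPODilator ℓ)
       (ι : ∀ X → X ⟶ NormalPODilator.obj 𝒯W X)
       (κ : ∀ X → NormalPODilator.obj W (NormalPODilator.obj 𝒯W X) ⟶ NormalPODilator.obj 𝒯W X)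
       : Set (lsuc ℓ) where
  private
    module W  = NormalPODilator W
    module 𝒯W = NormalPODilator 𝒯W
  field
    isInitial : ∀ X → IsInitialKruskalFixedPoint W.dilator X (𝒯W.obj X) (ι X) (κ X)
    ι-natural : ∀ {X Y} (f : QuasiEmbedding X Y) x →
                Poset._≈_ (𝒯W.obj Y)
                  (Func.to (ι Y) (f · x)) (𝒯W.mor f · Func.to (ι X) x)
    κ-natural : ∀ {X Y} (f : QuasiEmbedding X Y) σ →
                Poset._≈_ (𝒯W.obj Y)
                  (𝒯W.mor f · Func.to (κ X) σ)
                  (Func.to (κ Y) (W.mor (𝒯W.mor f) · σ))

module _ (X Y : PO ℓ) (h : Poset.Carrier X → Finite Y)
         (h-cong : ∀ {x x′} → Poset._≈_ X x x′ → h x ≐[ Y ] h x′) where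

  ∈-concatMap⁺ : ∀ {x y b} → x ∈[ X ] b → y ∈[ Y ] h x → y ∈[ Y ] concatMap h b
  ∈-concatMap⁺ x∈b y∈hx =
    Anyₚ.concatMap⁺ h (Membership.lose (Poset.Eq.setoid X)
      (λ x≈x′ → proj₁ (h-cong x≈x′)) x∈b y∈hx)

  ∈-concatMap⁻ : ∀ {y} b → y ∈[ Y ] concatMap h b →
                 ∃ λ x → x ∈[ X ] b × y ∈[ Y ] h x
  ∈-concatMap⁻ b y∈ =
    Membership.find (Poset.Eq.setoid X) (Anyₚ.concatMap⁻ h y∈)

∈-map⁺ : {X Y : PO ℓ} (f : QuasiEmbedding X Y) → ∀ {x b} →
         x ∈[ X ] b → f · x ∈[ Y ] List.map (f ·_) b
∈-map⁺ {X = X} {Y} f =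
  Membershipₚ.∈-map⁺ (Poset.Eq.setoid X) (Poset.Eq.setoid Y) (QuasiEmbedding.cong f)

∈-map⁻ : {X Y : PO ℓ} (f : QuasiEmbedding X Y) → ∀ {y b} →
         y ∈[ Y ] List.map (f ·_) b →
         ∃ λ x → x ∈[ X ] b × Poset._≈_ Y y (f · x)
∈-map⁻ {X = X} {Y} f = Membershipₚ.∈-map⁻ (Poset.Eq.setoid X) (Poset.Eq.setoid Y)

∈-resp : (X : PO ℓ) → ∀ {x x′ b} → Poset._≈_ X x x′ → x ∈[ X ] b → x′ ∈[ X ] b
∈-resp X = Membershipₚ.∈-resp-≈ (Poset.Eq.setoid X)

infixr 9 _∘ᵈ_

_∘ᵈ_ : PODilator ℓ → PODilator ℓ → PODilator ℓ
_∘ᵈ_ {ℓ} V W = record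
  { obj           = λ X → V.obj (W.obj X)
  ; mor           = λ f → V.mor (W.mor f)
  ; mor-cong      = λ f≗g → V.mor-cong (W.mor-cong f≗g)
  ; mor-id        = λ X σ → Poset.Eq.trans (V.obj (W.obj X))
                      (V.mor-cong (W.mor-id X) σ) (V.mor-id (W.obj X) σ)
  ; mor-∘         = λ {_} {_} {Z} g f σ → Poset.Eq.trans (V.obj (W.obj Z))
                      (V.mor-cong (W.mor-∘ g f) σ) (V.mor-∘ (W.mor g) (W.mor f) σ)
  ; mor-embedding = λ f e → V.mor-embedding (W.mor f) (W.mor-embedding f e)
  ; supp          = supp
  ; supp-cong     = λ X σ≈τ → supp-⊆ X (proj₁ (V.supp-cong _ σ≈τ))
                            , supp-⊆ X (proj₂ (V.supp-cong _ σ≈τ))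
  ; supp-natural  = λ f σ → natural₁ f σ , natural₂ f σ
  ; supp-range    = λ f e → range₁ f e , range₂ f e
  }
  where
  module V = PODilator V
  module W = PODilator W

  supp : ∀ X → Poset.Carrier (V.obj (W.obj X)) → Finite X
  supp X σ = concatMap (W.supp X) (V.supp (W.obj X) σ)

  module _ (X : PO ℓ) where
    ⋃⁺ : ∀ {s x b} → s ∈[ W.obj X ] b → x ∈[ X ] W.supp X s →
         x ∈[ X ] concatMap (W.supp X) b
    ⋃⁺ = ∈-concatMap⁺ (W.obj X) X (W.supp X) (W.supp-cong X)

    ⋃⁻ : ∀ {x} b → x ∈[ X ] concatMap (W.supp X) b →
         ∃ λ s → s ∈[ W.obj X ] b × x ∈[ X ] W.supp X s
    ⋃⁻ = ∈-concatMap⁻ (W.obj X) X (W.supp X) (W.supp-cong X)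

    supp-⊆ : ∀ {b c} → (∀ {s} → s ∈[ W.obj X ] b → s ∈[ W.obj X ] c) →
             ∀ {x} → x ∈[ X ] concatMap (W.supp X) b → x ∈[ X ] concatMap (W.supp X) c
    supp-⊆ {b} b⊆c x∈ with _ , s∈b , x∈s ← ⋃⁻ b x∈ = ⋃⁺ (b⊆c s∈b) x∈s

  module _ {X Y : PO ℓ} (f : QuasiEmbedding X Y) where
    natural₁ : ∀ σ {y} → y ∈[ Y ] supp Y (V.mor (W.mor f) · σ) →
               y ∈[ Y ] List.map (f ·_) (supp X σ)
    natural₁ σ y∈
      with s , s∈ , y∈s ← ⋃⁻ Y _ y∈
      with r , r∈ , s≈fr ← ∈-map⁻ (W.mor f) (proj₁ (V.supp-natural (W.mor f) σ) s∈)
      with x , x∈ , y≈fx ← ∈-map⁻ f (proj₁ (W.supp-natural f r) (proj₁ (W.supp-cong Y s≈fr) y∈s))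
      = ∈-resp Y (Poset.Eq.sym Y y≈fx) (∈-map⁺ f (⋃⁺ X r∈ x∈))

    natural₂ : ∀ σ {y} → y ∈[ Y ] List.map (f ·_) (supp X σ) →
               y ∈[ Y ] supp Y (V.mor (W.mor f) · σ)
    natural₂ σ y∈
      with x , x∈ , y≈fx ← ∈-map⁻ f y∈
      with r , r∈ , x∈r ← ⋃⁻ X _ x∈
      = ∈-resp Y (Poset.Eq.sym Y y≈fx)
          (⋃⁺ Y (proj₂ (V.supp-natural (W.mor f) σ) (∈-map⁺ (W.mor f) r∈))
                (proj₂ (W.supp-natural f r) (∈-map⁺ f x∈r)))

    module _ (e : IsEmbedding f) where
      range₁ : ∀ {σ} → rng (V.obj (W.obj X)) (V.obj (W.obj Y)) (function (V.mor (W.mor f))) σ →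
               ∀ {y} → y ∈[ Y ] supp Y σ → rng X Y (function f) y
      range₁ {σ} σ∈ y∈ with s , s∈ , y∈s ← ⋃⁻ Y (V.supp (W.obj Y) σ) y∈ =
        proj₁ (W.supp-range f e)
          (proj₁ (V.supp-range (W.mor f) (W.mor-embedding f e)) σ∈ s∈) y∈s

      range₂ : ∀ {σ} → (∀ {y} → y ∈[ Y ] supp Y σ → rng X Y (function f) y) →
               rng (V.obj (W.obj X)) (V.obj (W.obj Y)) (function (V.mor (W.mor f))) σ
      range₂ ⊆f = proj₂ (V.supp-range (W.mor f) (W.mor-embedding f e))
        (λ s∈ → proj₂ (W.supp-range f e) (λ y∈s → ⊆f (⋃⁺ Y s∈ y∈s)))

infixr 9 _∘ⁿ_

_∘ⁿ_ : NormalPODilator ℓ → NormalPODilator ℓ → NormalPODilator ℓ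
V ∘ⁿ W = record
  { dilator  = V.dilator ∘ᵈ W.dilator
  ; isNormal = normal
  }
  where
  module V = NormalPODilator V
  module W = NormalPODilator W

  normal : IsNormal (V.dilator ∘ᵈ W.dilator)
  normal X {σ} σ≤τ x∈
    with s , s∈ , x∈s ← ∈-concatMap⁻ (W.obj X) X (W.supp X) (W.supp-cong X) (V.supp _ σ) x∈
    with t , t∈ , s≤t ← V.isNormal (W.obj X) σ≤τ s∈
    with y , y∈ , x≤y ← W.isNormal X s≤t x∈s
    = y , ∈-concatMap⁺ (W.obj X) X (W.supp X) (W.supp-cong X) t∈ y∈ , x≤y

-- The multiset [x₀,…,xₘ₋₁] is given by the family i ↦ xᵢ; families that
-- agree up to a bijection of their index sets denote the same multiset.

record Multiset (A : Set a) : Set a where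
  constructor multiset
  field
    {size}   : ℕ
    elements : Vector A size

open Multiset

mapᵐ : (A → B) → Multiset A → Multiset B
mapᵐ f (multiset x) = multiset λ i → f (x i)

record MultisetEq {A : Set a} (_≈_ : Rel A r) (σ τ : Multiset A) : Set r where
  constructor bijects
  field
    bijection : Permutation (size σ) (size τ)
    pointwise : ∀ i → elements σ i ≈ elements τ (bijection ⟨$⟩ʳ i)

record MultisetLeq {A : Set a} (_≤_ : Rel A r) (σ τ : Multiset A) : Set r where
  constructor injects
  field
    injection : Fin (size σ) → Fin (size τ)
    injective : Injective _≡_ _≡_ injection
    pointwise : ∀ i → elements σ i ≤ elements τ (injection i)

perm-injective : (ρ : Permutation m k) → Injective _≡_ _≡_ (ρ ⟨$⟩ʳ_)
perm-injective ρ {i} {j} eq =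
  ≡.trans (≡.sym (Perm.inverseˡ ρ)) (≡.trans (≡.cong (ρ ⟨$⟩ˡ_) eq) (Perm.inverseˡ ρ))

module _ {_≈_ : Rel A r} where
  ≈ᵐ-refl : Reflexive _≈_ → Reflexive (MultisetEq _≈_)
  ≈ᵐ-refl rfl = bijects Perm.id λ _ → rfl

  ≈ᵐ-sym : Symmetric _≈_ → Symmetric (MultisetEq _≈_)
  ≈ᵐ-sym sy {σ} {τ} (bijects ρ eq) = bijects (Perm.flip ρ) λ j →
    sy (≡.subst (λ l → elements σ (ρ ⟨$⟩ˡ j) ≈ elements τ l) (Perm.inverseʳ ρ) (eq (ρ ⟨$⟩ˡ j)))

  ≈ᵐ-trans : Transitive _≈_ → Transitive (MultisetEq _≈_)
  ≈ᵐ-trans tr (bijects ρ eq) (bijects ρ′ eq′) = bijects (ρ Perm.∘ₚ ρ′) λ i → tr (eq i) (eq′ (ρ ⟨$⟩ʳ i))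

-- Going back and forth between the index sets is an injection p of
-- Fin m into itself, so every i satisfies pᵈ⁺¹ i ≡ i for some d.

module Cycle {_≤_ : Rel A r} (tr : Transitive _≤_) (x : Vector A m) (y : Vector A k)
  {g : Fin m → Fin k} (g-inj : Injective _≡_ _≡_ g) (x≤y : ∀ i → x i ≤ y (g i))
  {h : Fin k → Fin m} (h-inj : Injective _≡_ _≡_ h) (y≤x : ∀ j → y j ≤ x (h j)) where

  p^ : ℕ → Fin m → Fin m
  p^ zero    i = i
  p^ (suc d) i = h (g (p^ d i))

  cancel : ∀ i {b c} → b ℕ.< c → p^ b i ≡ p^ c i → ∃ λ d → p^ (suc d) i ≡ i
  cancel i {zero}  {suc c} _            eq = c , ≡.sym eq
  cancel i {suc b} {suc c} (ℕ.s≤s b<c) eq = cancel i b<c (g-inj (h-inj eq))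

  period : ∀ i → ∃ λ d → p^ (suc d) i ≡ i
  period i with b , c , b<c , eq ← pigeonhole (ℕₚ.n<1+n m) (λ (l : Fin (suc m)) → p^ (toℕ l) i) =
    cancel i b<c eq

  y≤p^ : ∀ i d → y (g i) ≤ x (p^ (suc d) i)
  y≤p^ i zero    = y≤x (g i)
  y≤p^ i (suc d) = tr (y≤p^ i d) (tr (x≤y _) (y≤x _))

  y≤x′ : ∀ i → y (g i) ≤ x i
  y≤x′ i with d , eq ← period i = ≡.subst (λ l → y (g i) ≤ x l) eq (y≤p^ i d)

  g⁻¹ : Fin k → Fin m
  g⁻¹ j = p^ (proj₁ (period (h j))) (h j)

  g-g⁻¹ : ∀ j → g (g⁻¹ j) ≡ j
  g-g⁻¹ j = h-inj (proj₂ (period (h j)))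

  bijection : Permutation m k
  bijection = permutation g g⁻¹ g-g⁻¹ (λ i → g-inj (g-g⁻¹ (g i)))

module _ {_≤_ : Rel A r} where
  ≤ᵐ-reflexive : {_≈_ : Rel A r} → (∀ {x y} → x ≈ y → x ≤ y) →
                 ∀ {σ τ} → MultisetEq _≈_ σ τ → MultisetLeq _≤_ σ τ
  ≤ᵐ-reflexive rfl (bijects ρ eq) = injects (ρ ⟨$⟩ʳ_) (perm-injective ρ) λ i → rfl (eq i)

  ≤ᵐ-trans : Transitive _≤_ → Transitive (MultisetLeq _≤_)
  ≤ᵐ-trans tr (injects g g-inj le) (injects h h-inj le′) =
    injects (λ i → h (g i)) (λ eq → g-inj (h-inj eq)) λ i → tr (le i) (le′ (g i))

  ≤ᵐ-antisym : {_≈_ : Rel A r} → Transitive _≤_ →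
               (∀ {x y} → x ≤ y → y ≤ x → x ≈ y) →
               ∀ {σ τ} → MultisetLeq _≤_ σ τ → MultisetLeq _≤_ τ σ → MultisetEq _≈_ σ τ
  ≤ᵐ-antisym tr asym {σ} {τ} (injects g g-inj le) (injects h h-inj le′) =
    bijects bijection λ i → asym (le i) (y≤x′ i)
    where open Cycle {_≤_ = _≤_} tr (elements σ) (elements τ) g-inj le h-inj le′

multisetPoset : PO ℓ → PO ℓ
multisetPoset X = record
  { Carrier = Multiset X.Carrier
  ; _≈_ = MultisetEq X._≈_
  ; _≤_ = MultisetLeq X._≤_
  ; isPartialOrder = record
    { isPreorder = record
      { isEquivalence = record
        { refl  = ≈ᵐ-refl X.Eq.refl
        ; sym   = ≈ᵐ-sym X.Eq.sym
        ; trans = ≈ᵐ-trans X.Eq.trans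
        }
      ; reflexive = ≤ᵐ-reflexive X.reflexive
      ; trans = ≤ᵐ-trans X.trans
      }
    ; antisym = ≤ᵐ-antisym X.trans X.antisym
    }
  }
  where module X = Poset X

multisetSupp : (X : PO ℓ) → Multiset (Poset.Carrier X) → Finite X
multisetSupp X σ = tabulate (elements σ)

∈-tabulate⁺ : (X : PO ℓ) {x : Vector (Poset.Carrier X) m} → ∀ i {y} →
              Poset._≈_ X y (x i) → y ∈[ X ] tabulate x
∈-tabulate⁺ X i eq = Anyₚ.tabulate⁺ i eq

𝕄 : NormalPODilator ℓ
𝕄 = record
  { dilator = record
    { obj           = multisetPoset
    ; mor           = λ f → record
      { function = record
        { to   = mapᵐ (f ·_)
        ; cong = λ (bijects ρ eq) → bijects ρ λ i → QuasiEmbedding.cong f (eq i)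
        }
      ; reflects = λ (injects g g-inj le) → injects g g-inj λ i → reflects f (le i)
      }
    ; mor-cong      = λ f≗g σ → bijects Perm.id λ i → f≗g (elements σ i)
    ; mor-id        = λ X σ → bijects Perm.id λ i → Poset.Eq.refl X
    ; mor-∘         = λ {_} {_} {Z} g f σ → bijects Perm.id λ i → Poset.Eq.refl Z
    ; mor-embedding = λ f e (injects g g-inj le) → injects g g-inj λ i → e (le i)
    ; supp          = multisetSupp
    ; supp-cong     = λ X {σ} {τ} σ≈τ → supp-⊆ X σ≈τ , supp-⊆ X (≈ᵐ-sym (Poset.Eq.sym X) {σ} {τ} σ≈τ)
    ; supp-natural  = λ {_} {Y} f σ →
        (λ {y} → ≡.subst (λ b → y ∈[ Y ] b) (≡.sym (Listₚ.map-tabulate (elements σ) (f ·_))))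
      , (λ {y} → ≡.subst (λ b → y ∈[ Y ] b) (Listₚ.map-tabulate (elements σ) (f ·_)))
    ; supp-range    = λ f e → range₁ f , range₂ f
    }
  ; isNormal = normal
  }
  where
  supp-⊆ : (X : PO ℓ) → ∀ {σ τ x} → MultisetEq (Poset._≈_ X) σ τ →
           x ∈[ X ] multisetSupp X σ → x ∈[ X ] multisetSupp X τ
  supp-⊆ X (bijects ρ eq) x∈ with i , x≈ ← Anyₚ.tabulate⁻ x∈ =
    ∈-tabulate⁺ X (ρ ⟨$⟩ʳ i) (Poset.Eq.trans X x≈ (eq i))

  normal : (X : PO ℓ) → ∀ {σ τ} → MultisetLeq (Poset._≤_ X) σ τ →
           multisetSupp X σ ≤fin[ X ] multisetSupp X τ
  normal X {_} {τ} (injects g _ le) x∈ with i , x≈ ← Anyₚ.tabulate⁻ x∈ =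
    elements τ (g i) , ∈-tabulate⁺ X (g i) (Poset.Eq.refl X) , Poset.≤-respˡ-≈ X (Poset.Eq.sym X x≈) (le i)

  module _ {X Y : PO ℓ} (f : QuasiEmbedding X Y) where
    range₁ : ∀ {σ} →
             (∃ λ ρ → MultisetEq (Poset._≈_ Y) (mapᵐ (f ·_) ρ) σ) →
             ∀ {y} → y ∈[ Y ] multisetSupp Y σ → rng X Y (function f) y
    range₁ {σ} (multiset x , bijects ρ eq) y∈ with j , y≈ ← Anyₚ.tabulate⁻ y∈ =
      x (ρ ⟨$⟩ˡ j) , Poset.Eq.trans Y
        (≡.subst (λ l → Poset._≈_ Y (f · x (ρ ⟨$⟩ˡ j)) (elements σ l)) (Perm.inverseʳ ρ) (eq (ρ ⟨$⟩ˡ j)))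
        (Poset.Eq.sym Y y≈)

    range₂ : ∀ {σ} → (∀ {y} → y ∈[ Y ] multisetSupp Y σ → rng X Y (function f) y) →
             ∃ λ ρ → MultisetEq (Poset._≈_ Y) (mapᵐ (f ·_) ρ) σ
    range₂ ⊆f =
      multiset (λ i → proj₁ (⊆f (∈-tabulate⁺ Y i (Poset.Eq.refl Y)))) ,
      bijects Perm.id λ i → proj₂ (⊆f (∈-tabulate⁺ Y i (Poset.Eq.refl Y)))

infixr 5 _⋆_

-- leaf x is x̄. Trees are raw terms; TreeEq below, which
-- identifies children up to reindexing, is the equality of 𝕋ₙ(X).

data Tree (n : ℕ) (A : Set a) : Set a where
  leaf : A → Tree n A
  _⋆_  : Fin n → Multiset (Tree n A) → Tree n A

mapᵗ : ∀ {n} → (A → B) → Tree n A → Tree n B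
mapᵗ f (leaf x)         = leaf (f x)
mapᵗ f (i ⋆ multiset t) = i ⋆ multiset λ l → mapᵗ f (t l)

leaves : ∀ {n} → Tree n A → List A
leaves (leaf x)         = [ x ]
leaves (i ⋆ multiset t) = concat (tabulate λ l → leaves (t l))

module _ {n : ℕ} (X : PO ℓ) where
  private
    module X = Poset X

  data TreeEq : Rel (Tree n X.Carrier) ℓ where
    leaf : ∀ {x y} → x X.≈ y → TreeEq (leaf x) (leaf y)
    _⋆_  : ∀ i {σ τ} → MultisetEq TreeEq σ τ → TreeEq (i ⋆ σ) (i ⋆ τ)

  -- The clauses defining the order by recursion on the two trees, read
  -- as introduction rules.

  data TreeLeq : Rel (Tree n X.Carrier) ℓ where
    leaf≤leaf : ∀ {x y} → x X.≤ y → TreeLeq (leaf x) (leaf y)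
    leaf≤⋆    : ∀ {x j τ} l → TreeLeq (leaf x) (elements τ l) → TreeLeq (leaf x) (j ⋆ τ)
    ⋆≤⋆       : ∀ {i σ τ} → MultisetLeq TreeLeq σ τ → TreeLeq (i ⋆ σ) (i ⋆ τ)
    ⋆≤⋆-sub   : ∀ {i j σ τ} → i Fin.≤ j → ∀ l → TreeLeq (i ⋆ σ) (elements τ l) →
                TreeLeq (i ⋆ σ) (j ⋆ τ)

sup : (Fin m → ℕ) → ℕ
sup {zero}  f = 0
sup {suc m} f = f zero ⊔ sup (f ∘ suc)

≤-sup : (f : Fin m → ℕ) → ∀ l → f l ℕ.≤ sup f
≤-sup f zero    = ℕₚ.m≤m⊔n _ _
≤-sup f (suc l) = ℕₚ.≤-trans (≤-sup (f ∘ suc) l) (ℕₚ.m≤n⊔m (f zero) _)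

sup-≤ : (f : Fin m → ℕ) → ∀ {b} → (∀ l → f l ℕ.≤ b) → sup f ℕ.≤ b
sup-≤ {zero}  f ub = ℕ.z≤n
sup-≤ {suc m} f ub = ℕₚ.⊔-lub (ub zero) (sup-≤ (f ∘ suc) (ub ∘ suc))

height : ∀ {n} → Tree n A → ℕ
height (leaf x)         = 0
height (i ⋆ multiset t) = suc (sup λ l → height (t l))

child<parent : ∀ {n} {i : Fin n} (σ : Multiset (Tree n A)) l →
               height (elements σ l) ℕ.< height (i ⋆ σ)
child<parent σ l = ℕ.s≤s (≤-sup (λ l → height (elements σ l)) l)

module TreeProperties {n : ℕ} (X : PO ℓ) where
  private
    module X = Poset X
    _≈_ = TreeEq {n = n} X
    _≤_ = TreeLeq {n = n} X

  ≈-refl : ∀ t → t ≈ t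
  ≈-refl (leaf x)         = leaf X.Eq.refl
  ≈-refl (i ⋆ multiset t) = i ⋆ (bijects Perm.id λ l → ≈-refl (t l))

  ≈-sym : ∀ {s t} → s ≈ t → t ≈ s
  ≈-sym (leaf x≈y) = leaf (X.Eq.sym x≈y)
  ≈-sym (_⋆_ i {σ} {τ} (bijects ρ eq)) = i ⋆ (bijects (Perm.flip ρ) λ l →
    ≡.subst (λ z → elements τ z ≈ elements σ (ρ ⟨$⟩ˡ l)) (Perm.inverseʳ ρ)
      (≈-sym (eq (ρ ⟨$⟩ˡ l))))

  ≈-trans : ∀ {s t u} → s ≈ t → t ≈ u → s ≈ u
  ≈-trans (leaf p)       (leaf q)          = leaf (X.Eq.trans p q)
  ≈-trans (i ⋆ (bijects ρ eq)) (.i ⋆ (bijects ρ′ eq′)) =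
    i ⋆ (bijects (ρ Perm.∘ₚ ρ′) λ l → ≈-trans (eq l) (eq′ (ρ ⟨$⟩ʳ l)))

  ≈⇒≤ : ∀ {s t} → s ≈ t → s ≤ t
  ≈⇒≤ (leaf p)       = leaf≤leaf (X.reflexive p)
  ≈⇒≤ (i ⋆ (bijects ρ eq)) = ⋆≤⋆ (injects (ρ ⟨$⟩ʳ_) (perm-injective ρ) λ l → ≈⇒≤ (eq l))

  ≤-trans : ∀ {s t u} → s ≤ t → t ≤ u → s ≤ u
  ≤-trans (leaf≤leaf p)      (leaf≤leaf q)       = leaf≤leaf (X.trans p q)
  ≤-trans (leaf≤leaf p)      (leaf≤⋆ l q)        = leaf≤⋆ l (≤-trans (leaf≤leaf p) q)
  ≤-trans (leaf≤⋆ l p)       (⋆≤⋆ (injects g _ le))  = leaf≤⋆ (g l) (≤-trans p (le l))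
  ≤-trans (leaf≤⋆ l p)       (⋆≤⋆-sub _ l′ q)    = leaf≤⋆ l′ (≤-trans (leaf≤⋆ l p) q)
  ≤-trans (⋆≤⋆ (injects g g-inj le)) (⋆≤⋆ (injects h h-inj le′)) =
    ⋆≤⋆ (injects (λ l → h (g l)) (λ eq → g-inj (h-inj eq)) λ l → ≤-trans (le l) (le′ (g l)))
  ≤-trans (⋆≤⋆ p)            (⋆≤⋆-sub i≤j l q)   = ⋆≤⋆-sub i≤j l (≤-trans (⋆≤⋆ p) q)
  ≤-trans (⋆≤⋆-sub i≤j l p)  (⋆≤⋆ (injects g _ le))  = ⋆≤⋆-sub i≤j (g l) (≤-trans p (le l))
  ≤-trans (⋆≤⋆-sub i≤j l p)  (⋆≤⋆-sub j≤k l′ q)  =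
    ⋆≤⋆-sub (ℕₚ.≤-trans i≤j j≤k) l′ (≤-trans (⋆≤⋆-sub i≤j l p) q)

  height-mono : ∀ {s t} → s ≤ t → height s ℕ.≤ height t
  height-mono (leaf≤leaf _) = ℕ.z≤n
  height-mono (leaf≤⋆ _ _)  = ℕ.z≤n
  height-mono (⋆≤⋆ {τ = τ} (injects g _ le)) = ℕ.s≤s (sup-≤ _ λ l →
    ℕₚ.≤-trans (height-mono (le l)) (≤-sup (λ l → height (elements τ l)) (g l)))
  height-mono (⋆≤⋆-sub {j = j} {τ = τ} _ l p) =
    ℕₚ.≤-trans (height-mono p) (ℕₚ.<⇒≤ (child<parent {i = j} τ l))

  no-cycle : ∀ {i s} (τ : Multiset (Tree n X.Carrier)) l →
             s ≤ elements τ l → ¬ ((i ⋆ τ) ≤ s)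
  no-cycle {i} τ l p q =
    ℕₚ.<-irrefl ≡.refl (ℕₚ.<-≤-trans (child<parent {i = i} τ l) (height-mono (≤-trans q p)))

  ≤-antisym : ∀ s t → s ≤ t → t ≤ s → s ≈ t
  ≤-antisym (leaf x) (leaf y) (leaf≤leaf p) (leaf≤leaf q) = leaf (X.antisym p q)
  ≤-antisym (i ⋆ σ) (j ⋆ τ) (⋆≤⋆-sub _ l p) q = contradiction q (no-cycle τ l p)
  ≤-antisym (i ⋆ σ) (j ⋆ τ) p (⋆≤⋆-sub _ l q) = contradiction p (no-cycle σ l q)
  ≤-antisym (i ⋆ multiset s) (.i ⋆ multiset t) (⋆≤⋆ (injects g g-inj le)) (⋆≤⋆ (injects h h-inj le′)) =
    i ⋆ (bijects bijection λ l → ≤-antisym (s l) (t (g l)) (le l) (y≤x′ l))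
    where open Cycle {_≤_ = _≤_} ≤-trans s t g-inj le h-inj le′

treePoset : ℕ → PO ℓ → PO ℓ
treePoset n X = record
  { Carrier = Tree n (Poset.Carrier X)
  ; _≈_ = TreeEq X
  ; _≤_ = TreeLeq X
  ; isPartialOrder = record
    { isPreorder = record
      { isEquivalence = record
        { refl  = ≈-refl _
        ; sym   = ≈-sym
        ; trans = ≈-trans
        }
      ; reflexive = ≈⇒≤
      ; trans = ≤-trans
      }
    ; antisym = ≤-antisym _ _
    }
  }
  where open TreeProperties X

∈-leaves⁺ : (X : PO ℓ) → ∀ {n} {i : Fin n} (σ : Multiset (Tree n (Poset.Carrier X))) l {y} →
            y ∈[ X ] leaves (elements σ l) → y ∈[ X ] leaves (i ⋆ σ)
∈-leaves⁺ X σ l y∈ = Anyₚ.concat⁺ (Anyₚ.tabulate⁺ l y∈)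

∈-leaves⁻ : (X : PO ℓ) → ∀ {n} {i : Fin n} (σ : Multiset (Tree n (Poset.Carrier X))) {y} →
            y ∈[ X ] leaves (i ⋆ σ) → ∃ λ l → y ∈[ X ] leaves (elements σ l)
∈-leaves⁻ X σ y∈ = Anyₚ.tabulate⁻ (Anyₚ.concat⁻ (tabulate (λ l → leaves (elements σ l))) y∈)

module _ {n : ℕ} (X : PO ℓ) where
  private
    module X = Poset X
  open TreeProperties {n = n} X

  leaves-⊆ : ∀ {s t : Tree n X.Carrier} {x} → TreeEq X s t → x ∈[ X ] leaves s → x ∈[ X ] leaves t
  leaves-⊆ (leaf x≈y) (here z≈x) = here (X.Eq.trans z≈x x≈y)
  leaves-⊆ (_⋆_ i {σ} {τ} (bijects ρ eq)) x∈ with l , x∈l ← ∈-leaves⁻ X {i = i} σ x∈ =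
    ∈-leaves⁺ X {i = i} τ (ρ ⟨$⟩ʳ l) (leaves-⊆ (eq l) x∈l)

  leaves-cong : ∀ {s t : Tree n X.Carrier} → TreeEq X s t → leaves s ≐[ X ] leaves t
  leaves-cong s≈t = leaves-⊆ s≈t , leaves-⊆ (≈-sym s≈t)

  leaves-normal : ∀ {s t : Tree n X.Carrier} → TreeLeq X s t → leaves s ≤fin[ X ] leaves t
  leaves-normal (leaf≤leaf {y = y} x≤y) (here z≈x) =
    y , here X.Eq.refl , X.≤-respˡ-≈ (X.Eq.sym z≈x) x≤y
  leaves-normal (leaf≤⋆ {j = j} {τ} l p) x∈ with y , y∈ , x≤y ← leaves-normal p x∈ =
    y , ∈-leaves⁺ X {i = j} τ l y∈ , x≤y
  leaves-normal (⋆≤⋆ {i} {σ} {τ} (injects g _ le)) x∈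
    with l , x∈l ← ∈-leaves⁻ X {i = i} σ x∈
    with y , y∈ , x≤y ← leaves-normal (le l) x∈l =
    y , ∈-leaves⁺ X {i = i} τ (g l) y∈ , x≤y
  leaves-normal (⋆≤⋆-sub {j = j} {τ = τ} _ l p) x∈ with y , y∈ , x≤y ← leaves-normal p x∈ =
    y , ∈-leaves⁺ X {i = j} τ l y∈ , x≤y

leaves-map : ∀ {n} (f : A → B) (t : Tree n A) → leaves (mapᵗ f t) ≡ List.map f (leaves t)
leaves-map f (leaf x)         = ≡.refl
leaves-map f (i ⋆ multiset t) = begin
  concat (tabulate λ l → leaves (mapᵗ f (t l)))
    ≡⟨ ≡.cong concat (Listₚ.tabulate-cong λ l → leaves-map f (t l)) ⟩
  concat (tabulate λ l → List.map f (leaves (t l)))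
    ≡⟨ ≡.cong concat (Listₚ.map-tabulate (leaves ∘ t) (List.map f)) ⟨
  concat (List.map (List.map f) (tabulate λ l → leaves (t l)))
    ≡⟨ Listₚ.concat-map (tabulate λ l → leaves (t l)) ⟩
  List.map f (concat (tabulate λ l → leaves (t l))) ∎
  where open ≡.≡-Reasoning

map-identity : ∀ {n} (X : PO ℓ) (t : Tree n (Poset.Carrier X)) →
               TreeEq X (mapᵗ (λ x → x) t) t
map-identity X (leaf x)         = leaf (Poset.Eq.refl X)
map-identity X (i ⋆ multiset t) = i ⋆ (bijects Perm.id λ l → map-identity X (t l))

map-compose : ∀ {n} (Z : PO ℓ) (g : B → Poset.Carrier Z) (f : A → B) (t : Tree n A) →
              TreeEq Z (mapᵗ (λ x → g (f x)) t) (mapᵗ g (mapᵗ f t))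
map-compose Z g f (leaf x)         = leaf (Poset.Eq.refl Z)
map-compose Z g f (i ⋆ multiset t) = i ⋆ (bijects Perm.id λ l → map-compose Z g f (t l))

module _ {n : ℕ} {X Y : PO ℓ} where
  private
    module X = Poset X
    module Y = Poset Y

  map-≗ : {f g : X.Carrier → Y.Carrier} → (∀ x → f x Y.≈ g x) → (t : Tree n X.Carrier) →
          TreeEq Y (mapᵗ f t) (mapᵗ g t)
  map-≗ f≗g (leaf x)         = leaf (f≗g x)
  map-≗ f≗g (i ⋆ multiset t) = i ⋆ (bijects Perm.id λ l → map-≗ f≗g (t l))

  module _ (f : QuasiEmbedding X Y) where
    map-cong : {s t : Tree n X.Carrier} → TreeEq X s t → TreeEq Y (mapᵗ (f ·_) s) (mapᵗ (f ·_) t)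
    map-cong (leaf p)       = leaf (QuasiEmbedding.cong f p)
    map-cong (i ⋆ (bijects ρ eq)) = i ⋆ (bijects ρ λ l → map-cong (eq l))

    map-reflects : (s t : Tree n X.Carrier) →
                   TreeLeq Y (mapᵗ (f ·_) s) (mapᵗ (f ·_) t) → TreeLeq X s t
    map-reflects (leaf x) (leaf y) (leaf≤leaf p) = leaf≤leaf (reflects f p)
    map-reflects (leaf x) (j ⋆ multiset t) (leaf≤⋆ l p) = leaf≤⋆ l (map-reflects (leaf x) (t l) p)
    map-reflects (i ⋆ multiset s) (.i ⋆ multiset t) (⋆≤⋆ (injects g g-inj le)) =
      ⋆≤⋆ (injects g g-inj λ l → map-reflects (s l) (t (g l)) (le l))
    map-reflects (i ⋆ σ@(multiset _)) (j ⋆ multiset t) (⋆≤⋆-sub i≤j l p) =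
      ⋆≤⋆-sub i≤j l (map-reflects (i ⋆ σ) (t l) p)

    map-embedding : IsEmbedding f → {s t : Tree n X.Carrier} → TreeLeq X s t →
                    TreeLeq Y (mapᵗ (f ·_) s) (mapᵗ (f ·_) t)
    map-embedding e (leaf≤leaf p)            = leaf≤leaf (e p)
    map-embedding e (leaf≤⋆ l p)             = leaf≤⋆ l (map-embedding e p)
    map-embedding e (⋆≤⋆ (injects g g-inj le))   = ⋆≤⋆ (injects g g-inj λ l → map-embedding e (le l))
    map-embedding e (⋆≤⋆-sub i≤j l p)        = ⋆≤⋆-sub i≤j l (map-embedding e p)

    leaves-natural : (t : Tree n X.Carrier) →
                     leaves (mapᵗ (f ·_) t) ≐[ Y ] List.map (f ·_) (leaves t)
    leaves-natural t = (λ {y} → ≡.subst (λ b → y ∈[ Y ] b) (leaves-map (f ·_) t))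
                     , (λ {y} → ≡.subst (λ b → y ∈[ Y ] b) (≡.sym (leaves-map (f ·_) t)))

    leaves-range⁺ : (s : Tree n X.Carrier) {t : Tree n Y.Carrier} → TreeEq Y (mapᵗ (f ·_) s) t →
                    ∀ {y} → y ∈[ Y ] leaves t → ∃ λ x → f · x Y.≈ y
    leaves-range⁺ s eq y∈
      with x , _ , y≈ ← ∈-map⁻ f (proj₁ (leaves-natural s) (proj₂ (leaves-cong Y eq) y∈)) =
      x , Y.Eq.sym y≈

    preimage : (t : Tree n Y.Carrier) → (∀ {y} → y ∈[ Y ] leaves t → ∃ λ x → f · x Y.≈ y) →
               ∃ λ s → TreeEq Y (mapᵗ (f ·_) s) t
    preimage (leaf y) h = Product.map leaf leaf (h (here Y.Eq.refl))
    preimage (i ⋆ τ@(multiset t)) h =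
      i ⋆ multiset (λ l → proj₁ (ih l)) , i ⋆ (bijects Perm.id λ l → proj₂ (ih l))
      where
      ih : ∀ l → ∃ λ s → TreeEq Y (mapᵗ (f ·_) s) (t l)
      ih l = preimage (t l) λ y∈ → h (∈-leaves⁺ Y {i = i} τ l y∈)

𝕋 : ℕ → NormalPODilator ℓ
𝕋 n = record
  { dilator = record
    { obj           = treePoset n
    ; mor           = λ f → record
      { function = record { to = mapᵗ (f ·_) ; cong = map-cong f }
      ; reflects = map-reflects f _ _
      }
    ; mor-cong      = λ {X} {Y} → map-≗ {X = X} {Y}
    ; mor-id        = map-identity
    ; mor-∘         = λ {_} {_} {Z} g f → map-compose Z (g ·_) (f ·_)
    ; mor-embedding = λ f e → map-embedding f e
    ; supp          = λ X → leaves
    ; supp-cong     = λ X → leaves-cong X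
    ; supp-natural  = leaves-natural
    ; supp-range    = λ f e → (λ (s , eq) → leaves-range⁺ f s eq) , λ {t} → preimage f t
    }
  ; isNormal = λ X → leaves-normal X
  }

-- 𝕋⁻ₙ₊₁(X) is a subset of 𝕋ₙ₊₁(X): equality and order on the pairs
-- below ignore the second component.

data IsMinus {n : ℕ} {A : Set a} : Pred (Tree (suc n) A) a where
  leaf : ∀ x → IsMinus (leaf x)
  0⋆_  : ∀ σ → IsMinus (zero ⋆ σ)

Tree⁻[1+_] : ℕ → Set a → Set a
Tree⁻[1+ n ] A = Σ (Tree (suc n) A) IsMinus

map-minus : ∀ {n} (f : A → B) {t : Tree (suc n) A} → IsMinus t → IsMinus (mapᵗ f t)
map-minus f (leaf x)          = leaf (f x)
map-minus f (0⋆ (multiset t)) = 0⋆ _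

mapᵗ⁻ : ∀ {n} → (A → B) → Tree⁻[1+ n ] A → Tree⁻[1+ n ] B
mapᵗ⁻ f (t , t⁻) = mapᵗ f t , map-minus f t⁻

minus-preimage : ∀ {n} {X Y : PO ℓ} (f : QuasiEmbedding X Y)
                 (s : Tree (suc n) (Poset.Carrier X)) {t : Tree (suc n) (Poset.Carrier Y)} →
                 TreeEq Y (mapᵗ (f ·_) s) t → IsMinus t → IsMinus s
minus-preimage f (leaf x)              eq       t⁻ = leaf x
minus-preimage f (zero ⋆ σ)            eq       t⁻ = 0⋆ σ
minus-preimage f (suc i ⋆ multiset _) (_ ⋆ _) ()

𝕋⁻[1+_] : ℕ → NormalPODilator ℓ
𝕋⁻[1+ n ] = record
  { dilator = record
    { obj           = λ X → On.poset (treePoset (suc n) X) (proj₁ {B = IsMinus})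
    ; mor           = λ f → record
      { function = record { to = mapᵗ⁻ (f ·_) ; cong = map-cong f }
      ; reflects = map-reflects f _ _
      }
    ; mor-cong      = λ {X} {Y} f≗g (t , _) → map-≗ {X = X} {Y} f≗g t
    ; mor-id        = λ X (t , _) → map-identity X t
    ; mor-∘         = λ {_} {_} {Z} g f (t , _) → map-compose Z (g ·_) (f ·_) t
    ; mor-embedding = λ f e → map-embedding f e
    ; supp          = λ X (t , _) → leaves t
    ; supp-cong     = λ X → leaves-cong X
    ; supp-natural  = λ f (t , _) → leaves-natural f t
    ; supp-range    = λ f e →
        (λ ((s , _) , eq) → leaves-range⁺ f s eq) ,
        λ {(t , t⁻)} ⊆f → let s , eq = preimage f t ⊆f in (s , minus-preimage f s eq t⁻) , eq
    }
  ; isNormal = λ X → leaves-normal X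
  }

π : ∀ {n} → Tree n (Tree⁻[1+ n ] A) → Tree (suc n) A
π (leaf (t , _))   = t
π (i ⋆ multiset s) = suc i ⋆ multiset λ l → π (s l)

π-cong : ∀ {n} (X : PO ℓ) {s t : Tree n (Tree⁻[1+ n ] (Poset.Carrier X))} →
         TreeEq (NormalPODilator.obj 𝕋⁻[1+ n ] X) s t → TreeEq X (π s) (π t)
π-cong X (leaf eq)      = eq
π-cong X (i ⋆ (bijects ρ eq)) = suc i ⋆ (bijects ρ λ l → π-cong X (eq l))

module _ (n : ℕ) (X : PO ℓ) where
  private
    module M∘𝕋 = NormalPODilator (𝕄 {ℓ} ∘ⁿ 𝕋 n)
    module 𝕋⁻  = NormalPODilator (𝕋⁻[1+_] {ℓ} n)

  ι : X ⟶ 𝕋⁻.obj X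
  ι = record
    { to   = λ x → leaf x , leaf x
    ; cong = leaf
    }

  κ : M∘𝕋.obj (𝕋⁻.obj X) ⟶ 𝕋⁻.obj X
  κ = record
    { to   = λ σ → zero ⋆ mapᵐ π σ , 0⋆ (mapᵐ π σ)
    ; cong = λ (bijects ρ eq) → zero ⋆ bijects ρ (λ i → π-cong X (eq i))
    }

{-# OPTIONS --safe #-}

-- An element of 𝕋⁻ₙ₊₁(X) lies below π s precisely when it lies below a leaf
-- of s, so π is an isomorphism of 𝕋ₙ(𝕋⁻ₙ₊₁(X)) with 𝕋ₙ₊₁(X), and the order
-- on trees with root 0 unfolds to the Kruskal condition.  For initiality, the
-- quasi embedding f into a fixed point Z is extracted from 𝕋ₙ(f) ∘ π⁻¹, a map
-- 𝕋ₙ₊₁(X) → 𝕋ₙ(Z) which, unlike f itself, is defined by structural recursion: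
-- a root i + 1 becomes i, and a tree with root 0 collapses to a single leaf.

module Submission where

open import Defs
open import Data.Fin.Base using (zero; suc)
import Data.Fin.Permutation as Perm
open import Data.List.Base using ([_])
open import Data.List.Relation.Unary.Any using (here)
import Data.List.Relation.Unary.Any.Properties as Anyₚ
open import Data.Nat.Base using (ℕ; suc; z≤n; s≤s)
open import Data.Product.Base using (∃; _×_; _,_; proj₁; proj₂)
open import Data.Sum.Base using (inj₁; inj₂)
open import Data.Sum.Function.Propositional using (_⊎-⇔_)
open import Function.Bundles using (Func; _⇔_; mk⇔; module Equivalence)
open import Function.Construct.Composition using (_⇔-∘_)
open import Function.Construct.Identity using (⇔-id)
open import Level using (Level)
open import Relation.Binary.Bundles using (Poset)

open Multiset

private
  variable
    ℓ : Level
    n : ℕ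

module _ (Z : PO ℓ) where
  private
    module Z = Poset Z

  leaf≤-leaves : ∀ {z y} (t : Tree n Z.Carrier) → y ∈[ Z ] leaves t → z Z.≤ y →
                 TreeLeq Z (leaf z) t
  leaf≤-leaves (leaf x) (here y≈x) z≤y = leaf≤leaf (Z.≤-respʳ-≈ y≈x z≤y)
  leaf≤-leaves (i ⋆ σ@(multiset t)) y∈ z≤y with l , y∈l ← ∈-leaves⁻ Z {i = i} σ y∈ =
    leaf≤⋆ l (leaf≤-leaves (t l) y∈l z≤y)

  -- The fixed point clauses mention supports, the tree order mentions children; this translates
  -- between the two. Normality of `leaves` gives one direction, and descending to the dominating
  -- leaf gives the other.
  leaf≤⇔≤fin-supp : ∀ {z} (σ : Multiset (Tree n Z.Carrier)) →
                    (∃ λ l → TreeLeq Z (leaf z) (elements σ l)) ⇔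
                    [ z ] ≤fin[ Z ] NormalPODilator.supp (𝕄 ∘ⁿ 𝕋 n) Z σ
  leaf≤⇔≤fin-supp {n = n} {z} σ = mk⇔ below above
    where
    below : (∃ λ l → TreeLeq Z (leaf z) (elements σ l)) →
            [ z ] ≤fin[ Z ] NormalPODilator.supp (𝕄 ∘ⁿ 𝕋 n) Z σ
    below (l , z≤) x∈ with y , y∈ , x≤y ← leaves-normal Z z≤ x∈ =
      y , Anyₚ.concatMap⁺ leaves (Anyₚ.tabulate⁺ l y∈) , x≤y

    above : [ z ] ≤fin[ Z ] NormalPODilator.supp (𝕄 ∘ⁿ 𝕋 n) Z σ →
            ∃ λ l → TreeLeq Z (leaf z) (elements σ l)
    above z≤fin
      with y , y∈ , z≤y ← z≤fin (here Z.Eq.refl)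
      with l , y∈l ← Anyₚ.tabulate⁻ (Anyₚ.concatMap⁻ leaves y∈)
      = l , leaf≤-leaves (elements σ l) y∈l z≤y

module _ {n : ℕ} (X : PO ℓ) where
  private
    module X  = Poset X
    module 𝕋⁻ = NormalPODilator (𝕋⁻[1+_] {ℓ} n)
    T⁻ = Tree⁻[1+ n ] X.Carrier

  π-mono : {s t : Tree n T⁻} → TreeLeq (𝕋⁻.obj X) s t → TreeLeq X (π s) (π t)
  π-mono (leaf≤leaf p) = p
  π-mono (leaf≤⋆ {x = _ , leaf x} {τ = multiset _} l p) = leaf≤⋆ l (π-mono p)
  -- The label has root `0`, the least index, so it may pass below the root `suc j`.
  π-mono (leaf≤⋆ {x = _ , 0⋆ σ} {τ = multiset _} l p)   = ⋆≤⋆-sub z≤n l (π-mono p)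
  π-mono (⋆≤⋆ {σ = multiset _} {multiset _} (injects g g-inj le)) =
    ⋆≤⋆ (injects g g-inj λ l → π-mono (le l))
  π-mono (⋆≤⋆-sub {σ = multiset _} {multiset _} i≤j l p) = ⋆≤⋆-sub (s≤s i≤j) l (π-mono p)

  -- A label is a leaf or has root `0`, so it can lie below a tree with root `suc j` only through a
  -- child, which is how a leaf of `𝕋 n` is compared.
  π-reflects : (s t : Tree n T⁻) → TreeLeq X (π s) (π t) → TreeLeq (𝕋⁻.obj X) s t
  π-reflects (leaf _) (leaf _) p = leaf≤leaf p
  π-reflects (leaf z@(_ , leaf x)) (j ⋆ multiset t) (leaf≤⋆ l p) =
    leaf≤⋆ l (π-reflects (leaf z) (t l) p)
  π-reflects (leaf z@(_ , 0⋆ σ)) (j ⋆ multiset t) (⋆≤⋆-sub _ l p) =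
    leaf≤⋆ l (π-reflects (leaf z) (t l) p)
  -- Passing below the root `0` would require `suc i` to be at most `0`.
  π-reflects (i ⋆ multiset s) (leaf (_ , 0⋆ σ)) (⋆≤⋆-sub () _ _)
  π-reflects (i ⋆ multiset s) (.i ⋆ multiset t) (⋆≤⋆ (injects g g-inj le)) =
    ⋆≤⋆ (injects g g-inj λ l → π-reflects (s l) (t (g l)) (le l))
  π-reflects (i ⋆ σ@(multiset _)) (j ⋆ multiset t) (⋆≤⋆-sub (s≤s i≤j) l p) =
    ⋆≤⋆-sub i≤j l (π-reflects (i ⋆ σ) (t l) p)

  -- By definition `proj₁ z` is `π (leaf z)`, so `π` carries the comparison over to leaves in `𝕋 n`.
  ≤π⇔≤fin-supp : (z : T⁻) (σ : Multiset (Tree n T⁻)) →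
                 (∃ λ l → TreeLeq X (proj₁ z) (π (elements σ l))) ⇔
                 [ z ] ≤fin[ 𝕋⁻.obj X ] NormalPODilator.supp (𝕄 ∘ⁿ 𝕋 n) (𝕋⁻.obj X) σ
  ≤π⇔≤fin-supp z σ = leaf≤⇔≤fin-supp (𝕋⁻.obj X) σ ⇔-∘ mk⇔
    (λ (l , p) → l , π-reflects (leaf z) (elements σ l) p)
    (λ (l , p) → l , π-mono p)

  π⁻¹ : Tree (suc n) X.Carrier → Tree n T⁻
  π⁻¹ (leaf x)             = leaf (leaf x , leaf x)
  π⁻¹ (zero ⋆ σ)           = leaf (zero ⋆ σ , 0⋆ σ)
  π⁻¹ (suc i ⋆ multiset t) = i ⋆ multiset λ l → π⁻¹ (t l)

  π-π⁻¹ : ∀ t → TreeEq X (π (π⁻¹ t)) t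
  π-π⁻¹ (leaf x)             = leaf X.Eq.refl
  π-π⁻¹ (zero ⋆ σ)           = TreeProperties.≈-refl X (zero ⋆ σ)
  π-π⁻¹ (suc i ⋆ multiset t) = suc i ⋆ bijects Perm.id λ l → π-π⁻¹ (t l)

π-natural : {X Y : PO ℓ} (f : QuasiEmbedding X Y) (s : Tree n (Tree⁻[1+ n ] (Poset.Carrier X))) →
            TreeEq Y (mapᵗ (f ·_) (π s)) (π (mapᵗ (mapᵗ⁻ (f ·_)) s))
π-natural {Y = Y} f (leaf (t , _)) = TreeProperties.≈-refl Y (mapᵗ (f ·_) t)
π-natural f (i ⋆ multiset s)       = suc i ⋆ bijects Perm.id λ l → π-natural f (s l)

-- Between two roots `0` the index condition holds trivially, so the two rules for comparing such
-- trees become the two alternatives of `κ≤κ`.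
isKruskalFixedPoint : (n : ℕ) (X : PO ℓ) →
  IsKruskalFixedPoint (NormalPODilator.dilator (𝕄 ∘ⁿ 𝕋 n)) X
    (NormalPODilator.obj 𝕋⁻[1+ n ] X) (ι n X) (κ n X)
isKruskalFixedPoint n X = record
  { disjoint = λ { _ ((_ , leaf _) , _ , ()) }
  ; ι≤ι      = λ { _ _ (leaf≤leaf p) → p }
  ; ι≤κ      = λ x τ → ≤π⇔≤fin-supp X (leaf x , leaf x) τ ⇔-∘ mk⇔
      (λ { (leaf≤⋆ l p) → l , p })
      (λ (l , p) → leaf≤⋆ l p)
  ; κ≰ι      = λ _ _ ()
  ; κ≤κ      = λ σ τ → (⇔-id _ ⊎-⇔ ≤π⇔≤fin-supp X (Func.to (κ n X) σ) τ) ⇔-∘ mk⇔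
      (λ { (⋆≤⋆ (injects g g-inj le)) → inj₁ (injects g g-inj λ i →
             π-reflects X (elements σ i) (elements τ (g i)) (le i))
         ; (⋆≤⋆-sub _ l p) → inj₂ (l , p) })
      (λ { (inj₁ (injects g g-inj le)) → ⋆≤⋆ (injects g g-inj λ i → π-mono X (le i))
         ; (inj₂ (l , p)) → ⋆≤⋆-sub z≤n l p })
  }

module Interpretation (n : ℕ) (X Z : PO ℓ) (ι′ : X ⟶ Z)
  (κ′ : NormalPODilator.obj (𝕄 ∘ⁿ 𝕋 n) Z ⟶ Z)
  (fixedPoint : IsKruskalFixedPoint (NormalPODilator.dilator (𝕄 ∘ⁿ 𝕋 n)) X Z ι′ κ′) where

  private
    module X  = Poset X
    module Z  = Poset Z
    module 𝕋⁻ = NormalPODilator (𝕋⁻[1+_] {ℓ} n)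
    module W  = NormalPODilator (𝕄 {ℓ} ∘ⁿ 𝕋 n)
    open Func ι′ using () renaming (to to ι₀; cong to ι-cong)
    open Func κ′ using () renaming (to to κ₀; cong to κ-cong)
    T⁻ = Tree⁻[1+ n ] X.Carrier
  open IsKruskalFixedPoint fixedPoint

  -- The values lie in `𝕋 n` of `Z` because `κ′` takes multisets of such trees, and children with
  -- root `suc i` have no value in `Z` itself.
  ⟦_⟧ : Tree (suc n) X.Carrier → Tree n Z.Carrier
  ⟦ leaf x ⟧             = leaf (ι₀ x)
  ⟦ zero ⋆ multiset t ⟧  = leaf (κ₀ (multiset λ l → ⟦ t l ⟧))
  ⟦ suc i ⋆ multiset t ⟧ = i ⋆ multiset λ l → ⟦ t l ⟧

  ⟦⟧-cong : ∀ {s t} → TreeEq X s t → TreeEq Z ⟦ s ⟧ ⟦ t ⟧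
  ⟦⟧-cong (leaf p)               = leaf (ι-cong p)
  ⟦⟧-cong (zero ⋆ bijects ρ eq)  = leaf (κ-cong (bijects ρ λ l → ⟦⟧-cong (eq l)))
  ⟦⟧-cong (suc i ⋆ bijects ρ eq) = i ⋆ bijects ρ λ l → ⟦⟧-cong (eq l)

  ⟦⟧-reflects : ∀ s t → TreeLeq Z ⟦ s ⟧ ⟦ t ⟧ → TreeLeq X s t
  ⟦⟧-reflects (leaf x) (leaf y) (leaf≤leaf p) = leaf≤leaf (ι≤ι x y p)
  ⟦⟧-reflects (leaf x) (zero ⋆ multiset t) (leaf≤leaf p)
    -- The leaf labelled `ι₀ x` is `⟦ leaf x ⟧`, so `q` is an instance for the induction hypothesis
    -- at a child.
    with l , q ← Equivalence.from (leaf≤⇔≤fin-supp Z (multiset λ l → ⟦ t l ⟧))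
                   (Equivalence.to (ι≤κ x _) p)
    = leaf≤⋆ l (⟦⟧-reflects (leaf x) (t l) q)
  ⟦⟧-reflects (leaf x) (suc j ⋆ multiset t) (leaf≤⋆ l p) =
    leaf≤⋆ l (⟦⟧-reflects (leaf x) (t l) p)
  ⟦⟧-reflects (zero ⋆ multiset s) (leaf y) (leaf≤leaf p) with () ← κ≰ι _ y p
  ⟦⟧-reflects (zero ⋆ σ@(multiset s)) (zero ⋆ multiset t) (leaf≤leaf p)
    with Equivalence.to (κ≤κ _ _) p
  ... | inj₁ (injects g g-inj le) =
    ⋆≤⋆ (injects g g-inj λ l → ⟦⟧-reflects (s l) (t (g l)) (le l))
  ... | inj₂ κ≤fin
    -- Likewise, the leaf labelled by the left-hand value of `κ₀` is `⟦ zero ⋆ σ ⟧`.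
    with l , q ← Equivalence.from (leaf≤⇔≤fin-supp Z (multiset λ l → ⟦ t l ⟧)) κ≤fin
    = ⋆≤⋆-sub z≤n l (⟦⟧-reflects (zero ⋆ σ) (t l) q)
  ⟦⟧-reflects (zero ⋆ σ@(multiset s)) (suc j ⋆ multiset t) (leaf≤⋆ l p) =
    ⋆≤⋆-sub z≤n l (⟦⟧-reflects (zero ⋆ σ) (t l) p)
  -- The right side has collapsed to a leaf, and no tree with a root index lies below a leaf.
  ⟦⟧-reflects (suc i ⋆ multiset s) (zero ⋆ multiset t) ()
  ⟦⟧-reflects (suc i ⋆ multiset s) (suc .i ⋆ multiset t) (⋆≤⋆ (injects g g-inj le)) =
    ⋆≤⋆ (injects g g-inj λ l → ⟦⟧-reflects (s l) (t (g l)) (le l))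
  ⟦⟧-reflects (suc i ⋆ σ@(multiset s)) (suc j ⋆ multiset t) (⋆≤⋆-sub i≤j l p) =
    ⋆≤⋆-sub (s≤s i≤j) l (⟦⟧-reflects (suc i ⋆ σ) (t l) p)

  value : T⁻ → Z.Carrier
  value (_ , leaf x)          = ι₀ x
  value (_ , 0⋆ (multiset t)) = κ₀ (multiset λ l → ⟦ t l ⟧)

  -- Through this identification `value` inherits congruence and order reflection from `⟦_⟧`.
  ⟦⟧-minus : (z : T⁻) → TreeEq Z ⟦ proj₁ z ⟧ (leaf (value z))
  ⟦⟧-minus (_ , leaf x)          = leaf Z.Eq.refl
  ⟦⟧-minus (_ , 0⋆ (multiset t)) = leaf Z.Eq.refl

  leaf-injective : ∀ {x y} → TreeEq {n = n} Z (leaf x) (leaf y) → x Z.≈ y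
  leaf-injective (leaf p) = p

  embedding : QuasiEmbedding (𝕋⁻.obj X) Z
  embedding = record
    { function = record
      { to   = value
      ; cong = λ {z} {w} eq → leaf-injective
          (≈-trans (≈-sym (⟦⟧-minus z)) (≈-trans (⟦⟧-cong eq) (⟦⟧-minus w)))
      }
    ; reflects = λ {z} {w} p → ⟦⟧-reflects (proj₁ z) (proj₁ w)
        (≤-trans (≈⇒≤ (⟦⟧-minus z)) (≤-trans (leaf≤leaf p) (≈⇒≤ (≈-sym (⟦⟧-minus w)))))
    }
    where open TreeProperties {n = n} Z

  -- Applied to each entry of a multiset under `κ₀`, this yields the morphism equation for `κ`.
  ⟦⟧-π : ∀ s → TreeEq Z ⟦ π s ⟧ (mapᵗ value s)
  ⟦⟧-π (leaf z)         = ⟦⟧-minus z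
  ⟦⟧-π (i ⋆ multiset s) = i ⋆ bijects Perm.id λ l → ⟦⟧-π (s l)

  IsMorphism : QuasiEmbedding (𝕋⁻.obj X) Z → Set ℓ
  IsMorphism f = (∀ x → f · Func.to (ι n X) x Z.≈ ι₀ x) ×
                 (∀ σ → f · Func.to (κ n X) σ Z.≈ κ₀ (W.mor f · σ))

  embedding-isMorphism : IsMorphism embedding
  embedding-isMorphism =
    (λ _ → Z.Eq.refl) ,
    (λ σ → κ-cong (bijects Perm.id λ l → ⟦⟧-π (elements σ l)))

  module _ (g : QuasiEmbedding (𝕋⁻.obj X) Z) (g-morphism : IsMorphism g) where

    -- The induction runs over all of `𝕋 (suc n)`, since children of a root `0` may lie outside the
    -- domain of `g`; `π⁻¹` exposes the subtrees where `g` applies.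
    ⟦⟧-unique : ∀ t → TreeEq Z ⟦ t ⟧ (mapᵗ (g ·_) (π⁻¹ X t))
    ⟦⟧-unique (leaf x)             = leaf (Z.Eq.sym (proj₁ g-morphism x))
    ⟦⟧-unique (suc i ⋆ multiset t) = i ⋆ bijects Perm.id λ l → ⟦⟧-unique (t l)
    ⟦⟧-unique (zero ⋆ multiset t)  = leaf (begin
      κ₀ (multiset λ l → ⟦ t l ⟧)   ≈⟨ κ-cong (bijects Perm.id λ l → ⟦⟧-unique (t l)) ⟩
      κ₀ (W.mor g · τ)              ≈⟨ proj₂ g-morphism τ ⟨
      -- The entries of `τ` are the children pulled back along `π`, so `κ` rebuilds the original
      -- tree.
      g · Func.to (κ n X) τ         ≈⟨ QuasiEmbedding.cong g (zero ⋆ bijects Perm.id λ l → π-π⁻¹ X (t l)) ⟩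
      g · (zero ⋆ multiset t , 0⋆ _) ∎)
      where
      open import Relation.Binary.Reasoning.Setoid Z.Eq.setoid
      τ : Multiset (Tree n T⁻)
      τ = multiset λ l → π⁻¹ X (t l)

    value-unique : ∀ z → value z Z.≈ g · z
    value-unique (_ , leaf x)            = leaf-injective (⟦⟧-unique (leaf x))
    value-unique (_ , 0⋆ σ@(multiset _)) = leaf-injective (⟦⟧-unique (zero ⋆ σ))

theorem6p5 : ∀ {ℓ : Level} (n : ℕ) → IsKruskalDerivative {ℓ} (𝕄 ∘ⁿ 𝕋 n) 𝕋⁻[1+ n ] (ι n) (κ n)
theorem6p5 n = record
  { isInitial = λ X → record
    { isKruskalFixedPoint = isKruskalFixedPoint n X
    ; initial = λ Z ι′ κ′ fp → let open Interpretation n X Z ι′ κ′ fp in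
        embedding , embedding-isMorphism , λ {g} g-morphism → value-unique g g-morphism
    }
  ; ι-natural = λ {_} {Y} _ _ → leaf (Poset.Eq.refl Y)
  ; κ-natural = λ f σ → zero ⋆ bijects Perm.id λ l → π-natural f (elements σ l)
  }
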